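{- Within the class $\mathbf{DLat}$ of bounded distributive lattices: (i) for regular cardinals $\lambda\le\kappa$, $\kappa\mathbf{proH}\subseteq\lambda\mathbf{proH}$, and the inclusion is proper when $\lambda<\kappa$; (ii) $\mathbf{proH}=\bigcap_\kappa\kappa\mathbf{proH}$ (over all regular cardinals $\kappa$); (iii) for every regular cardinal $\kappa$, $\kappa\mathbf{proH}\subsetneq\kappa\mathbf{JD}$; in particular $\omega_0\mathbf{proH}\subsetneq\omega_0\mathbf{JD}=\mathbf{DLat}$.
   Context: For a meet-semilattice $A$: $\mathcal{DM} A$ is the complete lattice of normal ideals ($N=N^{u\ell}$); an existing join $\bigvee S$ is distributive if $a\wedge\bigvee S=\bigvee\{a\wedge s:s\in S\}$ for all $a$; a D-ideal is a downset containing $\bigvee S$ for each subset $S$ of it with distributive join; $\mathcal{BL} A$ is the frame of D-ideals, and $\mathcal{DM} A\subseteq\mathcal{BL} A$. A relative annihilator is $\langle a,b\rangle=\{x:a\wedge x\le b\}$; $A$ is proHeyting if every relative annihilator is a normal ideal. A $\kappa$-join is a join of fewer than $\kappa$ elements. $\mathcal{BL}_\kappa(\mathcal{DM} A)$ is the sub-$\kappa$-frame of $\mathcal{BL} A$ generated by $\mathcal{DM} A$ (closure under finite meets and $\kappa$-joins in $\mathcal{BL} A$). $A$ is $\kappa$-proHeyting if $\mathcal{BL}_\kappa(\mathcal{DM} A)=\mathcal{DM} A$. $\kappa\mathbf{proH}$ (resp. $\mathbf{proH}$) is the class of $\kappa$-proHeyting (resp. proHeyting) bounded distributive lattices; $\kappa\mathbf{JD}$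 is the class of bounded distributive lattices in which every existing $\kappa$-join is distributive; $\omega_0$ is the first infinite cardinal. -}

module Defs where

open import Level using (Level; suc; Lift)
open import Data.Nat.Base using (ℕ)
open import Data.Product using (Σ; ∃; _×_; _,_; proj₁)
open import Function.Base using (_∘_)
open import Function.Bundles using (_↣_)
open import Relation.Nullary using (¬_)
open import Relation.Unary using (Pred; _∈_; _⊆_; _≐_; _∪_; ∅; ｛_｝)
open import Relation.Binary.Bundles using (Poset)
open import Relation.Binary.Lattice
  using (MeetSemilattice; BoundedLattice; IsDistributiveLattice)

private
  variable
    ℓ : Level

-- A cardinal is represented by any set of that cardinality, so "for every
-- cardinal" is "for every set": everything below depends on the set only up to
-- bijection.  The sets are those of the universe Set ℓ, in which the carriers
-- of the lattices also live.

infix 4 _≼_ _≺_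

_≼_ : Set ℓ → Set ℓ → Set ℓ
X ≼ Y = X ↣ Y

_≺_ : Set ℓ → Set ℓ → Set ℓ
X ≺ Y = X ≼ Y × ¬ (Y ≼ X)

ω₀ : Set ℓ
ω₀ {ℓ} = Lift ℓ ℕ

-- Regular: infinite, and not a sum of fewer than κ cardinals below κ.

record IsRegular (κ : Set ℓ) : Set (suc ℓ) where
  field
    infinite : ω₀ ≼ κ
    sums     : (I : Set ℓ) (F : I → Set ℓ) → I ≺ κ → (∀ i → F i ≺ κ) → Σ I F ≺ κ

record RegularCardinal ℓ : Set (suc ℓ) where
  field
    ∣_∣       : Set ℓ
    isRegular : IsRegular ∣_∣

open RegularCardinal public using (∣_∣)

module _ {c ℓ₁ ℓ₂} (P : Poset c ℓ₁ ℓ₂) where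
  open Poset P

  UpperBounds LowerBounds : ∀ {ℓ} → Pred Carrier ℓ → Pred Carrier _
  UpperBounds S y = ∀ {x} → x ∈ S → x ≤ y
  LowerBounds S y = ∀ {x} → x ∈ S → y ≤ x

  IsJoin IsMeet : ∀ {ℓ} → Pred Carrier ℓ → Carrier → Set _
  IsJoin S s = s ∈ UpperBounds S × s ∈ LowerBounds (UpperBounds S)
  IsMeet S s = s ∈ LowerBounds S × s ∈ UpperBounds (LowerBounds S)

  -- Classically, the sets with fewer than κ elements are the images of families
  -- I → Carrier with I ≺ κ; κ-joins are written as joins of such images.

  Image : ∀ {i} {I : Set i} → (I → Carrier) → Pred Carrier _
  Image f y = ∃ λ i → y ≈ f i

module Ideals (A : MeetSemilattice ℓ ℓ ℓ) where
  open MeetSemilattice A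

  IsNormal : Pred Carrier ℓ → Set ℓ
  IsNormal N = N ≐ LowerBounds poset (UpperBounds poset N)

  -- ｛ a ∧ s ∣ s ∈ S ｝
  _∧[_] : Carrier → Pred Carrier ℓ → Pred Carrier ℓ
  (a ∧[ S ]) y = ∃ λ s → s ∈ S × y ≈ a ∧ s

  IsDistributiveJoin : Pred Carrier ℓ → Carrier → Set ℓ
  IsDistributiveJoin S s =
    IsJoin poset S s × (∀ a → IsJoin poset (a ∧[ S ]) (a ∧ s))

  record IsDIdeal (D : Pred Carrier ℓ) : Set (suc ℓ) where
    field
      down : ∀ {x y} → x ≤ y → y ∈ D → x ∈ D
      join : (S : Pred Carrier ℓ) → S ⊆ D → ∀ {s} → IsDistributiveJoin S s → s ∈ D

  DIdeal : Set (suc ℓ)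
  DIdeal = Σ (Pred Carrier ℓ) IsDIdeal

  BL : Poset (suc ℓ) ℓ ℓ
  BL = record
    { Carrier        = DIdeal
    ; _≈_            = λ D E → proj₁ D ≐ proj₁ E
    ; _≤_            = λ D E → proj₁ D ⊆ proj₁ E
    ; isPartialOrder = record
      { isPreorder = record
        { isEquivalence = record
          { refl  = (λ x → x) , (λ x → x)
          ; sym   = λ (p , q) → q , p
          ; trans = λ (p , q) (p′ , q′) → (λ x → p′ (p x)) , (λ x → q (q′ x))
          }
        ; reflexive = proj₁
        ; trans     = λ p q x → q (p x)
        }
      ; antisym = λ p q → p , q
      }
    }

  -- Every normal ideal is a D-ideal, so as a subset of BL, DM is the whole
  -- collection of normal ideals.

  normal⇒DIdeal : ∀ {N} → IsNormal N → IsDIdeal N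
  normal⇒DIdeal (N⊆Nᵘˡ , Nᵘˡ⊆N) = record
    { down = λ x≤y y∈N → Nᵘˡ⊆N (λ u → trans x≤y (u y∈N))
    ; join = λ S S⊆N ((_ , least) , _) → Nᵘˡ⊆N (λ u → least (λ x∈S → u (S⊆N x∈S)))
    }

  DM : Pred DIdeal ℓ
  DM = IsNormal ∘ proj₁

  -- BL⟨ κ ⟩ G is the sub-κ-frame of BL generated by G.

  data BL⟨_⟩ (κ : Set ℓ) {g} (G : Pred DIdeal g) : DIdeal → Set (suc ℓ Level.⊔ g) where
    generator : ∀ {D} → D ∈ G → D ∈ BL⟨ κ ⟩ G
    top       : ∀ {D} → IsMeet BL ∅ D → D ∈ BL⟨ κ ⟩ G
    meet      : ∀ {D E F} → D ∈ BL⟨ κ ⟩ G → E ∈ BL⟨ κ ⟩ G →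
                IsMeet BL (｛ D ｝ ∪ ｛ E ｝) F → F ∈ BL⟨ κ ⟩ G
    κ-join    : ∀ {I : Set ℓ} → I ≺ κ → (D : I → DIdeal) →
                (∀ i → D i ∈ BL⟨ κ ⟩ G) →
                ∀ {E} → IsJoin BL (Image BL D) E → E ∈ BL⟨ κ ⟩ G

  IsκProHeyting : Set ℓ → Set (suc ℓ)
  IsκProHeyting κ = BL⟨ κ ⟩ DM ≐ DM

  ⟨_,_⟩ : Carrier → Carrier → Pred Carrier ℓ
  ⟨ a , b ⟩ x = a ∧ x ≤ b

  IsProHeyting : Set ℓ
  IsProHeyting = ∀ a b → IsNormal ⟨ a , b ⟩

  IsκJoinDistributive : Set ℓ → Set (suc ℓ)
  IsκJoinDistributive κ =
    ∀ {I : Set ℓ} → I ≺ κ → (f : I → Carrier) →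
    ∀ {s} → IsJoin poset (Image poset f) s → IsDistributiveJoin (Image poset f) s

record DLat ℓ : Set (suc ℓ) where
  field
    boundedLattice : BoundedLattice ℓ ℓ ℓ
  open BoundedLattice boundedLattice public
  field
    isDistributiveLattice : IsDistributiveLattice _≈_ _≤_ _∨_ _∧_

proH : Pred (DLat ℓ) ℓ
proH A = Ideals.IsProHeyting (DLat.meetSemilattice A)

_-proH _-JD : Set ℓ → Pred (DLat ℓ) (suc ℓ)
(κ -proH) A = Ideals.IsκProHeyting (DLat.meetSemilattice A) κ
(κ -JD)   A = Ideals.IsκJoinDistributive (DLat.meetSemilattice A) κ

{-# OPTIONS --safe #-}
module Submission where

-- If A is proHeyting then every D-ideal D is normal: for x ∈ Dᵘˡ the relative
-- annihilators show that x is the distributive join of the elements of D below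
-- x.  Conversely ⟨ a , b ⟩ is the join in BL of its principal subideals, hence
-- normal as soon as A is κ-proHeyting for some regular κ above its size; such a
-- κ is a successor cardinal, made of well-founded trees.
--
-- Proper inclusions are witnessed by rings of sets.  For μ-proH ⊈ κ-proH take
-- the small (fewer than μ elements) subsets of μ, with or without an extra point
-- ∞, and the whole of μ ∪ {∞}.  This lattice is complete, and the D-ideal of the
-- sets avoiding ∞ is the μ-indexed join of the singletons but is not normal.
--
-- For κ-JD ⊈ κ-proH take two copies lo b and two copies hi b of κ, and the sets
-- that are, for each b, small on lo b or contain lo b ∪ hi b, and that are empty
-- or co-small on hi.  They are closed under κ-unions, so κ-joins are distributive.
-- The sets inside lo b form a normal ideal, but the join in BL of these two
-- ideals consists of the sets avoiding hi, whose only upper bound is the whole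
-- space.

open import Defs
open import Level using (Level; suc; Lift; lift; lower)
open import Axiom.ExcludedMiddle using (ExcludedMiddle)
open import Axiom.Extensionality.Propositional using (Extensionality; lower-extensionality)
open import Axiom.UniquenessOfIdentityProofs.WithK using (uip)
open import Data.Bool.Base using (Bool; true; false; T; if_then_else_; not)
  renaming (_∧_ to _∧ᵇ_; _∨_ to _∨ᵇ_)
open import Data.Bool.Properties using (T-irrelevant; T-∧; T-∨; _≟_; not-¬)
open import Data.Empty.Polymorphic using (⊥)
open import Data.Fin.Base as Fin using (Fin; combine)
import Data.Fin.Properties as Fin
open import Data.Maybe.Base using (Maybe; just; nothing; maybe′)
open import Data.Maybe.Properties using (just-injective)
open import Data.Nat.Base as ℕ using (ℕ)
import Data.Nat.Properties as ℕ
open import Data.Product using (Σ; ∃; _×_; _,_; proj₁; proj₂; swap)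
open import Data.Sum.Base using (_⊎_; inj₁; inj₂; [_,_]′)
open import Data.Sum.Properties using (inj₁-injective)
open import Data.Unit.Polymorphic using (⊤)
open import Function.Base using (_∘_; id)
open import Function.Bundles using (_↣_; mk↣; module Equivalence; module Injection)
open import Function.Construct.Composition using (_↣-∘_)
open import Function.Construct.Identity using (↣-id)
open import Relation.Binary.Definitions using (tri<; tri≈; tri>)
open import Relation.Binary.Lattice using (MeetSemilattice; IsLattice; IsDistributiveLattice)
open import Relation.Binary.PropositionalEquality using (_≡_; refl; sym; trans; cong; subst)
open import Relation.Nullary using (¬_; yes; no; contradiction; ⌊_⌋)
open import Relation.Nullary.Decidable
  using (True; map′; toWitness; fromWitness; toWitnessFalse; decidable-stable)
open import Relation.Unary using (Pred; _∈_; _∉_; _⊆_; _⊂_; _≐_; _∩_; ∁; ∅; ⋂; U)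

open Injection using (to; injective)

private variable
  ℓ : Level
  X Y Z κ : Set ℓ

-- Cardinals

≼-≺-trans : X ≼ Y → Y ≺ Z → X ≺ Z
≼-≺-trans X≼Y (Y≼Z , Z⋠Y) = Y≼Z ↣-∘ X≼Y , λ Z≼X → Z⋠Y (X≼Y ↣-∘ Z≼X)

≺-≼-trans : X ≺ Y → Y ≼ Z → X ≺ Z
≺-≼-trans (X≼Y , Y⋠X) Y≼Z = Y≼Z ↣-∘ X≼Y , λ Z≼X → Y⋠X (Z≼X ↣-∘ Y≼Z)

finite⇒≺ : ∀ {n} → ω₀ ≼ κ → X ↣ Fin n → X ≺ κ
finite⇒≺ {n = n} ω₀≼κ X↣n =
  ω₀≼κ ↣-∘ (mk↣ (Fin.toℕ-injective ∘ cong lower) ↣-∘ X↣n) ,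
  λ κ≼X → let f = X↣n ↣-∘ (κ≼X ↣-∘ ω₀≼κ) in
    Fin.ℕ→Fin-notInjective (to f ∘ lift) (cong lower ∘ injective f)

max : ∀ {n} (f : Fin n → ℕ) → ∃ λ m → ∀ k → f k ℕ.≤ m
max {ℕ.zero}  f = 0 , λ ()
max {ℕ.suc n} f with m , f≤m ← max (f ∘ Fin.suc) = f Fin.zero ℕ.⊔ m , λ where
  Fin.zero    → ℕ.m≤m⊔n _ _
  (Fin.suc k) → ℕ.≤-trans (f≤m k) (ℕ.m≤n⊔m _ _)

-- Finite sets and the regularity of `ω₀`.

module _ {ℓ} (em : ExcludedMiddle ℓ) where

  private variable
    I : Set ℓ

  -- If the codes `g i` were unbounded, elements with ever larger codes could be chosen in turn, and
  -- this sequence would embed `ω₀` in `I`.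
  ≺ω₀⇒finite : I ≺ ω₀ → ∃ λ n → I ↣ Fin n
  ≺ω₀⇒finite {I} (g , ω₀⋠I) with em {∃ λ n → ∀ i → lower (to g i) ℕ.< n}
  ... | yes (n , g<n) = n , mk↣ λ {i} {j} eq →
    injective g (cong lift (Fin.fromℕ<-injective _ _ (g<n i) (g<n j) eq))
  ... | no unbounded = contradiction (mk↣ {to = h ∘ lower} h-injective) ω₀⋠I
    where
    above : ∀ n → ∃ λ i → n ℕ.≤ lower (to g i)
    above n with em {∃ λ i → n ℕ.≤ lower (to g i)}
    ... | yes found = found
    ... | no none   = contradiction (n , λ i → ℕ.≰⇒> (λ n≤ → none (i , n≤))) unbounded

    h : ℕ → I
    h ℕ.zero    = proj₁ (above 0)
    h (ℕ.suc n) = proj₁ (above (ℕ.suc (lower (to g (h n)))))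

    h-mono : ∀ {m n} → m ℕ.<′ n → lower (to g (h m)) ℕ.< lower (to g (h n))
    h-mono {m} ℕ.≤′-refl     = proj₂ (above (ℕ.suc (lower (to g (h m)))))
    h-mono (ℕ.≤′-step m<′n) = ℕ.<-trans (h-mono m<′n) (proj₂ (above _))

    h-injective : ∀ {m n : Lift ℓ ℕ} → h (lower m) ≡ h (lower n) → m ≡ n
    h-injective {lift m} {lift n} eq with ℕ.<-cmp m n
    ... | tri< m<n _ _ = contradiction (cong (lower ∘ to g) eq) (ℕ.<⇒≢ (h-mono (ℕ.<⇒<′ m<n)))
    ... | tri≈ _ m≡n _ = cong lift m≡n
    ... | tri> _ _ n<m = contradiction (cong (lower ∘ to g) (sym eq)) (ℕ.<⇒≢ (h-mono (ℕ.<⇒<′ n<m)))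

  -- Turns a family over `I` into one over `Fin n`, where recursion is possible; `nothing` marks the
  -- indices outside the range of `g`, which later receive a neutral default.
  partialInverse : ∀ {n} (g : I ↣ Fin n) → ∃ λ (h : Fin n → Maybe I) → ∀ i → h (to g i) ≡ just i
  partialInverse {I} {n} g = h , h∘g
    where
    h : Fin n → Maybe I
    h k with em {∃ λ i → to g i ≡ k}
    ... | yes (i , _) = just i
    ... | no _        = nothing

    h∘g : ∀ i → h (to g i) ≡ just i
    h∘g i with em {∃ λ j → to g j ≡ to g i}
    ... | yes (j , eq) = cong just (injective g eq)
    ... | no none      = contradiction (i , refl) none

  ω₀-isRegular : IsRegular (ω₀ {ℓ})
  ω₀-isRegular = record
    { infinite = ↣-id _
    ; sums     = λ I F I≺ω₀ F≺ω₀ →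
        finite⇒≺ (↣-id _) (proj₂ (Σ-finite I F (≺ω₀⇒finite I≺ω₀) (≺ω₀⇒finite ∘ F≺ω₀)))
    }
    where
    Σ-finite : (I : Set ℓ) (F : I → Set ℓ) → (∃ λ n → I ↣ Fin n) → (∀ i → ∃ λ m → F i ↣ Fin m) →
               ∃ λ k → Σ I F ↣ Fin k
    Σ-finite I F (n , g) fin = n ℕ.* m , mk↣ {to = code} code-injective
      where
      h = proj₁ (partialInverse g)

      -- A common bound on the sizes of the summands, so that the sum embeds in `Fin (n * m)`;
      -- indices outside the range of `g` count as size 0.
      bound : ∃ λ m → ∀ k → maybe′ (proj₁ ∘ fin) 0 (h k) ℕ.≤ m
      bound = max _

      m = proj₁ bound

      fin≤m : ∀ i → proj₁ (fin i) ℕ.≤ m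
      fin≤m i =
        subst (λ x → maybe′ (proj₁ ∘ fin) 0 x ℕ.≤ m) (proj₂ (partialInverse g) i) (proj₂ bound (to g i))

      code : Σ I F → Fin (n ℕ.* m)
      code (i , x) = combine (to g i) (Fin.inject≤ (to (proj₂ (fin i)) x) (fin≤m i))

      code-injective : ∀ {p q} → code p ≡ code q → p ≡ q
      code-injective {i , x} {j , y} eq
        with gi≡gj , x≡y ← Fin.combine-injective (to g i) _ (to g j) _ eq
        with refl ← injective g gi≡gj
        = cong (i ,_) (injective (proj₂ (fin i)) (Fin.inject≤-injective _ _ _ _ x≡y))

-- Excluded middle for types is a choice operator.  Applied to Bool-valued
-- predicates it selects, by extensionality, an element depending only on the
-- extension, which stands in for quotients.

module Choice {ℓ} (em : ExcludedMiddle ℓ) (ext : Extensionality ℓ ℓ) {A : Set ℓ} where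

  choose : (A → Bool) → Maybe A
  choose S with em {∃ λ a → T (S a)}
  ... | yes (a , _) = just a
  ... | no _        = nothing

  choose-∈ : ∀ S {a} → choose S ≡ just a → T (S a)
  choose-∈ S eq with em {∃ λ a → T (S a)}
  choose-∈ S refl | yes (_ , a∈S) = a∈S

  choose-just : ∀ S {a} → T (S a) → ∃ λ b → choose S ≡ just b
  choose-just S {a} a∈S with em {∃ λ a → T (S a)}
  ... | yes (b , _) = b , refl
  ... | no empty    = contradiction (a , a∈S) empty

  pick : Pred A ℓ → Maybe A
  pick P = choose (λ a → ⌊ em {P a} ⌋)

  pick-cong : ∀ {P Q} → P ≐ Q → pick P ≡ pick Q
  pick-cong {P} {Q} (P⊆Q , Q⊆P) = cong choose (lower-extensionality ℓ ℓ ext same)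
    where
    same : ∀ a → ⌊ em {P a} ⌋ ≡ ⌊ em {Q a} ⌋
    same a with em {P a} | em {Q a}
    ... | yes _ | yes _ = refl
    ... | yes p | no ¬q = contradiction (P⊆Q p) ¬q
    ... | no ¬p | yes q = contradiction (Q⊆P q) ¬p
    ... | no _  | no _  = refl

  pick-∈ : ∀ {P a} → pick P ≡ just a → a ∈ P
  pick-∈ eq = toWitness (choose-∈ _ eq)

  pick-just : ∀ {P a} → a ∈ P → ∃ λ b → b ∈ P × pick P ≡ just b
  pick-just a∈P with b , eq ← choose-just _ (fromWitness a∈P) = b , pick-∈ eq , eq

-- Tree contains X and is closed under pairing, hence infinite with Tree × Tree ≼
-- Tree.  The elements of Ord, modulo ≈, are the ordinals below the successor
-- cardinal of Tree: sup f is the least ordinal above all f a.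

module Successor {ℓ} (em : ExcludedMiddle ℓ) (ext : Extensionality ℓ ℓ) (X : Set ℓ) where

  open Choice em ext

  data Tree : Set ℓ where
    nil  : Tree
    leaf : X → Tree
    node : Tree → Tree → Tree

  node-injective : ∀ {a b a′ b′} → node a b ≡ node a′ b′ → a ≡ a′ × b ≡ b′
  node-injective refl = refl , refl

  data Ord : Set ℓ where
    zero : Ord
    sup  : (Tree → Ord) → Ord

  infix 4 _≤_ _<_ _≈_

  _≤_ : Ord → Ord → Set ℓ
  zero  ≤ y     = ⊤
  sup f ≤ zero  = ⊥
  sup f ≤ sup g = ∀ i → ∃ λ j → f i ≤ g j

  _<_ : Ord → Ord → Set ℓ
  x < zero  = ⊥
  x < sup g = ∃ λ j → x ≤ g j

  _≈_ : Ord → Ord → Set ℓ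
  x ≈ y = x ≤ y × y ≤ x

  ≤-refl : ∀ x → x ≤ x
  ≤-refl zero    = _
  ≤-refl (sup f) = λ i → i , ≤-refl (f i)

  ≤-trans : ∀ x y z → x ≤ y → y ≤ z → x ≤ z
  ≤-trans zero    y       z       _ _ = _
  ≤-trans (sup f) (sup g) (sup h) p q i
    with j , fi≤gj ← p i with k , gj≤hk ← q j = k , ≤-trans (f i) (g j) (h k) fi≤gj gj≤hk

  ≤-<-trans : ∀ x y z → x ≤ y → y < z → x < z
  ≤-<-trans x y (sup h) x≤y (k , y≤hk) = k , ≤-trans x y (h k) x≤y y≤hk

  <-≤-trans : ∀ x y z → x < y → y ≤ z → x < z
  <-≤-trans x (sup g) (sup h) (j , x≤gj) y≤z
    with k , gj≤hk ← y≤z j = k , ≤-trans x (g j) (h k) x≤gj gj≤hk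

  <-irrefl : ∀ x → ¬ x < x
  <-irrefl (sup f) (i , x≤fi) =
    <-irrefl (f i) (<-≤-trans (f i) (sup f) (f i) (i , ≤-refl (f i)) x≤fi)

  <⇒≤ : ∀ x y → x < y → x ≤ y
  <⇒≤ zero    _       _          = _
  <⇒≤ (sup f) (sup g) (j , x≤gj) i =
    j , <⇒≤ (f i) (g j) (<-≤-trans (f i) (sup f) (g j) (i , ≤-refl (f i)) x≤gj)

  -- Excluded middle decides whether `sup g` lies below some `f i`. If not, induction puts every
  -- `f i` strictly below `sup g`, which is what `sup f ≤ sup g` unfolds to.
  ≤-total : ∀ x y → x ≤ y ⊎ y < x
  ≤-total zero    y       = inj₁ _
  ≤-total (sup f) zero    = inj₂ (nil , _)
  ≤-total (sup f) (sup g) with em {∃ λ i → sup g ≤ f i}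
  ... | yes y<x = inj₂ y<x
  ... | no y≮x  = inj₁ below
    where
    below : ∀ i → f i < sup g
    below i with ≤-total (sup g) (f i)
    ... | inj₁ y≤fi = contradiction (i , y≤fi) y≮x
    ... | inj₂ fi<y = fi<y

  ≈-trans : ∀ x y z → x ≈ y → y ≈ z → x ≈ z
  ≈-trans x y z (x≤y , y≤x) (y≤z , z≤y) = ≤-trans x y z x≤y y≤z , ≤-trans z y x z≤y y≤x

  -- `pick` sees only the extension of `x ≈_`, so each class has exactly one canonical member, and
  -- `Tree⁺` is the quotient of `Ord` by `≈`.
  IsCanonical : Pred Ord ℓ
  IsCanonical x = pick (x ≈_) ≡ just x

  pick-≈ : ∀ x y → x ≈ y → pick (x ≈_) ≡ pick (y ≈_)
  pick-≈ x y (x≤y , y≤x) = pick-cong (≈-trans y x _ (y≤x , x≤y) , ≈-trans x y _ (x≤y , y≤x))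

  canonical : ∀ x → ∃ λ y → x ≈ y × IsCanonical y
  canonical x with y , x≈y , eq ← pick-just {P = x ≈_} (≤-refl x , ≤-refl x) =
    y , x≈y , trans (sym (pick-≈ x y x≈y)) eq

  Tree⁺ : Set ℓ
  Tree⁺ = ∃ IsCanonical

  ≈⇒≡ : ∀ {p q : Tree⁺} → proj₁ p ≈ proj₁ q → p ≡ q
  ≈⇒≡ {x , cx} {y , cy} x≈y with refl ← just-injective (trans (sym cx) (trans (pick-≈ x y x≈y) cy))
    = cong (x ,_) (uip cx cy)

  -- The segment below x, coded in Tree; junk above x.

  code : Ord → Ord → Tree
  code zero    y = nil
  code (sup f) y with em {∃ λ i → y ≤ f i}
  ... | yes (i , _) = node i (code (f i) y)
  ... | no _        = nil

  -- The code records the indices followed on the way down from `x` until `y` is reached up to `≈`;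
  -- equal paths end at equivalent ordinals.
  code-injective : ∀ x {y z} → y ≤ x → z ≤ x → code x y ≡ code x z → y ≈ z
  code-injective zero    {zero} {zero} _ _ _ = _ , _
  code-injective (sup f) {y} {z} y≤x z≤x eq with em {∃ λ i → y ≤ f i} | em {∃ λ i → z ≤ f i}
  code-injective (sup f) {y} {z} y≤x z≤x eq | yes (i , y≤fi) | yes (j , z≤fj)
    with refl , eq′ ← node-injective eq = code-injective (f i) y≤fi z≤fj eq′
  code-injective (sup f) {y} {z} y≤x z≤x eq | no y≮x | no z≮x =
    ≤-trans y (sup f) z y≤x (≮⇒≥ z≮x) , ≤-trans z (sup f) y z≤x (≮⇒≥ y≮x)
    where
    ≮⇒≥ : ∀ {y} → ¬ y < sup f → sup f ≤ y
    ≮⇒≥ {y} y≮x with ≤-total (sup f) y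
    ... | inj₁ x≤y = x≤y
    ... | inj₂ y<x = contradiction y<x y≮x

  -- The Burali-Forti argument: an injection `e` would let `decode` list all canonical ordinals
  -- along `Tree`, and `sup decode` would exceed each of them, its own representative `w` included.
  Tree⁺⋠Tree : ¬ Tree⁺ ≼ Tree
  Tree⁺⋠Tree e = <-irrefl w (≤-<-trans w (decode a) w w≤decode
    (<-≤-trans (decode a) (sup decode) w (a , ≤-refl (decode a)) s≤w))
    where
    decode : Tree → Ord
    decode a with em {∃ λ p → to e p ≡ a}
    ... | yes ((x , _) , _) = x
    ... | no _              = zero

    w   = proj₁ (canonical (sup decode))
    s≤w = proj₁ (proj₁ (proj₂ (canonical (sup decode))))

    p : Tree⁺
    p = w , proj₂ (proj₂ (canonical (sup decode)))

    a = to e p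

    w≤decode : w ≤ decode a
    w≤decode with em {∃ λ q → to e q ≡ a}
    ... | yes (q , eq) = subst (λ q → w ≤ proj₁ q) (injective e (sym eq)) (≤-refl w)
    ... | no none      = contradiction (p , refl) none

  module _ (Z : Set ℓ) where

    -- A transfinite enumeration of Z without repetitions: step x is an element
    -- of Z not listed before stage x, if there is one.

    Listed : Ord → Pred Z ℓ
    Listed zero    z = ⊥
    Listed (sup f) z = ∃ λ i → z ∈ Listed (f i) ⊎ pick (∁ (Listed (f i))) ≡ just z

    step : Ord → Maybe Z
    step x = pick (∁ (Listed x))

    Listed-mono : ∀ x y → x ≤ y → Listed x ⊆ Listed y
    Listed′-mono : ∀ x y → x ≤ y → ∀ {z} →
      z ∈ Listed x ⊎ step x ≡ just z → z ∈ Listed y ⊎ step y ≡ just z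

    Listed-mono (sup f) (sup g) x≤y (i , p)
      with j , fi≤gj ← x≤y i = j , Listed′-mono (f i) (g j) fi≤gj p

    Listed′-mono x y x≤y (inj₁ p) = inj₁ (Listed-mono x y x≤y p)
    -- Either `x ≈ y`, and both stages choose the same element, or `x < y`, and the choice of stage
    -- `x` is already listed at `y`.
    Listed′-mono x y x≤y (inj₂ p) with ≤-total y x
    ... | inj₁ y≤x = inj₂ (trans (pick-cong ((λ ∉y → ∉y ∘ Listed-mono x y x≤y) ,
                                             (λ ∉x → ∉x ∘ Listed-mono y x y≤x))) p)
    Listed′-mono x (sup g) x≤y (inj₂ p) | inj₂ (j , x≤gj) =
      inj₁ (j , Listed′-mono x (g j) x≤gj (inj₂ p))

    listed⇒step : ∀ x {z} → z ∈ Listed x → ∃ λ y → y < x × step y ≡ just z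
    listed⇒step (sup f) (i , inj₂ p) = f i , (i , ≤-refl (f i)) , p
    listed⇒step (sup f) (i , inj₁ p)
      with y , y<fi , eq ← listed⇒step (f i) p = y , (i , <⇒≤ y (f i) y<fi) , eq

    step⇒listed : ∀ x y → x < y → ∀ {z} → step x ≡ just z → z ∈ Listed y
    step⇒listed x (sup g) (j , x≤gj) p = j , Listed′-mono x (g j) x≤gj (inj₂ p)

    step-cong : ∀ x y → x ≈ y → step x ≡ step y
    step-cong x y (x≤y , y≤x) =
      pick-cong ((λ ∉x → ∉x ∘ Listed-mono y x y≤x) , (λ ∉y → ∉y ∘ Listed-mono x y x≤y))

    -- If the enumeration exhausts `Z` by stage `x`, sending `z` to the stage that lists it embeds
    -- `Z` in the segment below `x`. Otherwise every stage contributes a new element, and the stages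
    -- embed in `Z`.
    compare : Tree⁺ ≼ Z ⊎ (Z ≼ Tree × Z ≼ Tree⁺)
    compare with em {∃ λ x → ∀ z → z ∈ Listed x}
    ... | yes (x , all) = inj₂
      ( mk↣ {to = code x ∘ index}
          (λ {z} {z′} → index-injective z z′ ∘
            code-injective x (<⇒≤ _ x (index<x z)) (<⇒≤ _ x (index<x z′)))
      , mk↣ {to = λ z → rep z , rep-canonical z} (λ {z} {z′} eq → index-injective z z′
          (≈-trans _ (rep z) _ (index≈rep z)
            (subst (λ p → proj₁ p ≈ index z′) (sym eq) (swap (index≈rep z′))))))
      where
      index : Z → Ord
      index z = proj₁ (listed⇒step x (all z))

      index<x : ∀ z → index z < x
      index<x z = proj₁ (proj₂ (listed⇒step x (all z)))

      step-index : ∀ z → step (index z) ≡ just z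
      step-index z = proj₂ (proj₂ (listed⇒step x (all z)))

      rep : Z → Ord
      rep z = proj₁ (canonical (index z))

      index≈rep : ∀ z → index z ≈ rep z
      index≈rep z = proj₁ (proj₂ (canonical (index z)))

      rep-canonical : ∀ z → rep z ∈ IsCanonical
      rep-canonical z = proj₂ (proj₂ (canonical (index z)))

      index-injective : ∀ z z′ → index z ≈ index z′ → z ≡ z′
      index-injective z z′ i≈i′ =
        just-injective (trans (sym (step-index z)) (trans (step-cong _ _ i≈i′) (step-index z′)))
    ... | no unfinished = inj₁ (mk↣ {to = λ p → proj₁ (next (proj₁ p))}
      (λ {p} {q} → ≈⇒≡ ∘ next-injective (proj₁ p) (proj₁ q)))
      where
      next : ∀ x → ∃ λ z → z ∉ Listed x × step x ≡ just z
      next x with em {∃ λ z → z ∉ Listed x}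
      ... | yes (z , z∉x) = pick-just z∉x
      ... | no finished   =
        contradiction (x , λ z → decidable-stable em (λ z∉x → finished (z , z∉x))) unfinished

      next-≮ : ∀ x y → proj₁ (next x) ≡ proj₁ (next y) → ¬ x < y
      next-≮ x y eq x<y = proj₁ (proj₂ (next y))
        (subst (_∈ Listed y) eq (step⇒listed x y x<y (proj₂ (proj₂ (next x)))))

      next-≤ : ∀ x y → proj₁ (next x) ≡ proj₁ (next y) → x ≤ y
      next-≤ x y eq with ≤-total x y
      ... | inj₁ x≤y = x≤y
      ... | inj₂ y<x = contradiction y<x (next-≮ y x (sym eq))

      next-injective : ∀ x y → proj₁ (next x) ≡ proj₁ (next y) → x ≈ y
      next-injective x y eq = next-≤ x y eq , next-≤ y x (sym eq)

  ≺⁺⇒≼Tree : Z ≺ Tree⁺ → Z ≼ Tree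
  ≺⁺⇒≼Tree {Z = Z} (_ , ⁺⋠Z) with compare Z
  ... | inj₁ ⁺≼Z         = contradiction ⁺≼Z ⁺⋠Z
  ... | inj₂ (Z≼Tree , _) = Z≼Tree

  Tree≺⁺ : Tree ≺ Tree⁺
  Tree≺⁺ with compare Tree
  ... | inj₁ ⁺≼Tree        = contradiction ⁺≼Tree Tree⁺⋠Tree
  ... | inj₂ (_ , Tree≼⁺) = Tree≼⁺ , Tree⁺⋠Tree

  ω₀≼Tree : ω₀ ≼ Tree
  ω₀≼Tree = mk↣ (cong lift ∘ comb-injective _ _)
    where
    comb : ℕ → Tree
    comb ℕ.zero    = nil
    comb (ℕ.suc n) = node nil (comb n)

    comb-injective : ∀ m n → comb m ≡ comb n → m ≡ n
    comb-injective ℕ.zero    ℕ.zero    _  = refl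
    comb-injective (ℕ.suc m) (ℕ.suc n) eq =
      cong ℕ.suc (comb-injective m n (proj₂ (node-injective eq)))

  -- For regularity, an index set and summands below `Tree⁺` all embed in `Tree`; pairing index and
  -- element by `node` embeds the sum there too.
  successor : RegularCardinal ℓ
  successor = record
    { ∣_∣       = Tree⁺
    ; isRegular = record
      { infinite = proj₁ Tree≺⁺ ↣-∘ ω₀≼Tree
      ; sums     = λ I F I≺⁺ F≺⁺ → ≼-≺-trans (pair (≺⁺⇒≼Tree I≺⁺) (≺⁺⇒≼Tree ∘ F≺⁺)) Tree≺⁺
      }
    }
    where
    pair : {I : Set ℓ} {F : I → Set ℓ} → I ≼ Tree → (∀ i → F i ≼ Tree) → Σ I F ≼ Tree
    pair {I} {F} g h = mk↣ pair-injective
      where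
      code₂ : Σ I F → Tree
      code₂ (i , x) = node (to g i) (to (h i) x)

      pair-injective : ∀ {p q} → code₂ p ≡ code₂ q → p ≡ q
      pair-injective {i , x} {j , y} eq
        with gi≡gj , hx≡hy ← node-injective eq
        with refl ← injective g gi≡gj
        = cong (i ,_) (injective (h i) hx≡hy)

  X≺successor : X ≺ ∣ successor ∣
  X≺successor = ≼-≺-trans (mk↣ {to = leaf} λ { refl → refl }) Tree≺⁺

-- Meet-semilattices and their D-ideals

module Semilattice (A : MeetSemilattice ℓ ℓ ℓ) where
  open MeetSemilattice A renaming (refl to ≤-refl; trans to ≤-trans; reflexive to ≤-reflexive)
  open Ideals A

  ∧-monoʳ : ∀ a {x y} → x ≤ y → a ∧ x ≤ a ∧ y
  ∧-monoʳ a x≤y = ∧-greatest (x∧y≤x a _) (≤-trans (x∧y≤y a _) x≤y)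

  -- The case where `a` is `s` already yields that `s` is the least upper bound.
  distributiveJoin : ∀ {S s} → s ∈ UpperBounds poset S →
    (∀ a {u} → (∀ {x} → x ∈ S → a ∧ x ≤ u) → a ∧ s ≤ u) → IsDistributiveJoin S s
  distributiveJoin {S} {s} upper least =
    (upper , λ {u} S≤u → ≤-trans (∧-greatest ≤-refl ≤-refl)
      (least s (λ x∈S → ≤-trans (x∧y≤y s _) (S≤u x∈S)))) ,
    λ a → (λ (x , x∈S , y≈) → ≤-trans (≤-reflexive y≈) (∧-monoʳ a (upper x∈S))) ,
          λ bound → least a (λ x∈S → bound (_ , x∈S , Eq.refl))

  -- Distributivity makes `a ∧ s` the join of elements `a ∧ x` that are all below `b`. Conversely,
  -- membership of `s` in such ideals will serve as the test for distributivity.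
  annihilator-isDIdeal : ∀ a b → IsDIdeal ⟨ a , b ⟩
  annihilator-isDIdeal a b = record
    { down = λ x≤y a∧y≤b → ≤-trans (∧-monoʳ a x≤y) a∧y≤b
    ; join = λ S S⊆ (_ , dist) →
        proj₂ (dist a) (λ (x , x∈S , y≈) → ≤-trans (≤-reflexive y≈) (S⊆ x∈S))
    }

  annihilator : Carrier → Carrier → DIdeal
  annihilator a b = ⟨ a , b ⟩ , annihilator-isDIdeal a b

  ↓ : Carrier → Pred Carrier ℓ
  ↓ a x = x ≤ a

  ↓-isNormal : ∀ a → IsNormal (↓ a)
  ↓-isNormal a = (λ x≤a u → u x≤a) , λ x∈ → x∈ id

  principal : Carrier → DIdeal
  principal a = ↓ a , normal⇒DIdeal (↓-isNormal a)

  normal-resp-≐ : ∀ {M N} → M ≐ N → IsNormal M → IsNormal N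
  normal-resp-≐ (M⊆N , N⊆M) (_ , closed) =
    (λ x∈N u → u x∈N) , λ x∈ → M⊆N (closed (λ u → x∈ (u ∘ N⊆M)))

  whole : DIdeal
  whole = (λ _ → ⊤) , record { down = λ _ _ → _ ; join = λ _ _ _ → _ }

  infixr 7 _⊓_

  _⊓_ : DIdeal → DIdeal → DIdeal
  (D , isD) ⊓ (E , isE) = D ∩ E , record
    { down = λ x≤y (y∈D , y∈E) → IsDIdeal.down isD x≤y y∈D , IsDIdeal.down isE x≤y y∈E
    ; join = λ S S⊆ dist →
        IsDIdeal.join isD S (proj₁ ∘ S⊆) dist , IsDIdeal.join isE S (proj₂ ∘ S⊆) dist
    }

  ∩-isNormal : ∀ {M N} → IsNormal M → IsNormal N → IsNormal (M ∩ N)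
  ∩-isNormal (_ , closedM) (_ , closedN) =
    (λ x∈ u → u x∈) , λ x∈ → closedM (λ u → x∈ (u ∘ proj₁)) , closedN (λ u → x∈ (u ∘ proj₂))

  -- Only joins matter: DM is always closed under finite meets in BL.

  normal-joins⇒κProHeyting : ∀ {κ} →
    (∀ {I} → I ≺ κ → (D : I → DIdeal) → (∀ i → D i ∈ DM) →
      ∀ {E} → IsJoin BL (Image BL D) E → E ∈ DM) →
    IsκProHeyting κ
  normal-joins⇒κProHeyting {κ} joins = BL⊆DM , generator
    where
    BL⊆DM : BL⟨ κ ⟩ DM ⊆ DM
    BL⊆DM (generator D∈DM) = D∈DM
    BL⊆DM (top (_ , greatest)) = (λ x∈D u → u x∈D) , λ _ → greatest {whole} (λ ()) _
    BL⊆DM (meet {D} {E} {F} D∈ E∈ (lower , greatest)) =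
      normal-resp-≐ (D⊓E⊆F , F⊆D⊓E) (∩-isNormal (BL⊆DM D∈) (BL⊆DM E∈))
      where
      D⊓E⊆F : proj₁ (D ⊓ E) ⊆ proj₁ F
      D⊓E⊆F = greatest {D ⊓ E} λ { (inj₁ refl) → proj₁ ; (inj₂ refl) → proj₂ }

      F⊆D⊓E : proj₁ F ⊆ proj₁ (D ⊓ E)
      F⊆D⊓E x∈F = lower {D} (inj₁ refl) x∈F , lower {E} (inj₂ refl) x∈F
    BL⊆DM (κ-join I≺κ D D∈ {E} isJoin) = joins I≺κ D (λ i → BL⊆DM (D∈ i)) {E} isJoin

  ProHeyting⇒normal : IsProHeyting → ∀ D → D ∈ DM
  ProHeyting⇒normal proHeyting (D , isDIdeal) = (λ x∈D u → u x∈D) , λ {x} x∈Dᵘˡ →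
    join (D ∩ ↓ x) proj₁ (distributiveJoin proj₂ λ a {u} bound →
      ≤-trans (∧-greatest ≤-refl (x∧y≤y a x))
        -- For `d` in `D`, also `d ∧ x` is in `D` and below `x`, so `bound` puts `D` inside
        -- `⟨ a ∧ x , u ⟩`; normality of this annihilator then gives that it contains `x`.
        (proj₂ (proHeyting (a ∧ x) u) λ upper → x∈Dᵘˡ λ {d} d∈D → upper {d} (
          ≤-trans (∧-greatest (≤-trans (x∧y≤x _ d) (x∧y≤x a x))
              (∧-greatest (x∧y≤y _ d) (≤-trans (x∧y≤x _ d) (x∧y≤y a x))))
            (bound (down (x∧y≤x d x) d∈D , x∧y≤y d x)))))
    where open IsDIdeal isDIdeal

  isJoin-principals : ∀ D → IsJoin BL (Image BL (λ (d : ∃ (proj₁ D)) → principal (proj₁ d))) D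
  isJoin-principals D =
    (λ ((d , d∈D) , E≐↓d) x∈E → IsDIdeal.down (proj₂ D) (proj₁ E≐↓d x∈E) d∈D) ,
    λ {E} upper {d} d∈D → upper {principal d} ((d , d∈D) , id , id) ≤-refl

  -- Whatever is below the join of `N` is below every upper bound of `N`, so normality puts it in
  -- `N`.
  join⇒principal : ∀ {N a} → IsNormal N → IsJoin poset N a → N ≐ ↓ a
  join⇒principal (_ , closed) (upper , least) = upper , λ x≤a → closed (λ u → ≤-trans x≤a (least u))

  -- By completeness normal ideals are principal, say `↓ (a i)`. The join `s` of the `a i` is
  -- distributive, so it lies in every D-ideal containing them, and the join in `BL` is `↓ s`.
  complete⇒κProHeyting : ∀ {κ} → IsκJoinDistributive κ → (∀ S → ∃ (IsJoin poset S)) →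
    IsκProHeyting κ
  complete⇒κProHeyting jd complete = normal-joins⇒κProHeyting λ I≺κ D D∈DM {E} (upper , least) →
    let a        = λ i → proj₁ (complete (proj₁ (D i)))
        D≐↓a     = λ i → join⇒principal {proj₁ (D i)} {a i} (D∈DM i) (proj₂ (complete (proj₁ (D i))))
        s , join = complete (Image poset a)
        s∈E      = IsDIdeal.join (proj₂ E) (Image poset a)
                     (λ (i , x≈a) → IsDIdeal.down (proj₂ E) (≤-reflexive x≈a)
                       (upper {D i} (i , id , id) (proj₂ (D≐↓a i) ≤-refl)))
                     (jd I≺κ a join)
    in normal-resp-≐ {↓ s} {proj₁ E}
         ( (λ x≤s → IsDIdeal.down (proj₂ E) x≤s s∈E)
         , least {principal s} (λ (i , F≐D) x∈F →
             ≤-trans (proj₁ (D≐↓a i) (proj₁ F≐D x∈F)) (proj₁ join (i , Eq.refl))))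
         (↓-isNormal s)

  BL-mono : ∀ {μ κ} → μ ≼ κ → BL⟨ μ ⟩ DM ⊆ BL⟨ κ ⟩ DM
  BL-mono μ≼κ (generator D∈)             = generator D∈
  BL-mono μ≼κ (top {D} isMeet)           = top {D = D} isMeet
  BL-mono μ≼κ (meet {F = F} D∈ E∈ isMeet) = meet {F = F} (BL-mono μ≼κ D∈) (BL-mono μ≼κ E∈) isMeet
  BL-mono μ≼κ (κ-join I≺μ D D∈ {E} isJoin) =
    κ-join (≺-≼-trans I≺μ μ≼κ) D (λ i → BL-mono μ≼κ (D∈ i)) {E} isJoin

  κProHeyting-antitone : ∀ {μ κ} → μ ≼ κ → IsκProHeyting κ → IsκProHeyting μ
  κProHeyting-antitone μ≼κ (BL⊆DM , _) = BL⊆DM ∘ BL-mono μ≼κ , generator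

  κProHeyting⇒ProHeyting : (∀ X → ∃ λ (κ : RegularCardinal ℓ) → X ≺ ∣ κ ∣) →
    (∀ (κ : RegularCardinal ℓ) → IsκProHeyting ∣ κ ∣) → IsProHeyting
  κProHeyting⇒ProHeyting above proHeyting a b with κ , D≺κ ← above (∃ ⟨ a , b ⟩) =
    proj₁ (proHeyting κ) (κ-join D≺κ (principal ∘ proj₁) (λ _ → generator (↓-isNormal _))
      {annihilator a b} (isJoin-principals (annihilator a b)))

  module _ (em : ExcludedMiddle (suc ℓ)) where

    -- Excluded middle resizes the intersection of all D-ideals above S to a
    -- predicate at level ℓ.

    Generated : Pred Carrier ℓ → Pred Carrier (suc ℓ)
    Generated S x = ∀ (E : DIdeal) → S ⊆ proj₁ E → x ∈ proj₁ E

    generated : Pred Carrier ℓ → DIdeal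
    generated S = (λ x → Lift ℓ (True (em {Generated S x}))) , record
      { down = λ {x} {y} x≤y (lift y∈) → lift (fromWitness {a? = em {Generated S x}} λ E S⊆E →
                 IsDIdeal.down (proj₂ E) x≤y (toWitness {a? = em {Generated S y}} y∈ E S⊆E))
      ; join = λ S′ S′⊆ {s} dist → lift (fromWitness {a? = em {Generated S s}} λ E S⊆E →
                 IsDIdeal.join (proj₂ E) S′
                   (λ {x} x∈ → toWitness {a? = em {Generated S x}} (lower (S′⊆ x∈)) E S⊆E) dist)
      }

    ⊆-generated : ∀ {S} → S ⊆ proj₁ (generated S)
    ⊆-generated {S} {x} x∈S = lift (fromWitness {a? = em {Generated S x}} λ E S⊆E → S⊆E x∈S)

    generated-least : ∀ {S} E → S ⊆ proj₁ E → proj₁ (generated S) ⊆ proj₁ E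
    generated-least {S} E S⊆E {x} (lift x∈) = toWitness {a? = em {Generated S x}} x∈ E S⊆E

    generated-isJoin : ∀ {I : Set ℓ} (f : I → Carrier) →
      IsJoin BL (Image BL (principal ∘ f)) (generated (Image poset f))
    generated-isJoin f =
      (λ (i , E≐↓) x∈E → IsDIdeal.down (proj₂ (generated (Image poset f)))
        (proj₁ E≐↓ x∈E) (⊆-generated (i , Eq.refl))) ,
      λ {E} upper → generated-least E λ (i , x≈fi) →
        upper {principal (f i)} (i , id , id) (≤-reflexive x≈fi)

    -- The D-ideal generated by the image of `f` is a `κ`-join of principal ideals, hence normal,
    -- and its upper bounds are above `s`; so it contains `s`. Any annihilator containing the image
    -- then contains `s`.
    κProHeyting⇒κJoinDistributive : ∀ {κ} → IsκProHeyting κ → IsκJoinDistributive κ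
    κProHeyting⇒κJoinDistributive (BL⊆DM , _) I≺κ f {s} (s-upper , s-least) =
      distributiveJoin s-upper λ a {u} bound → generated-least (annihilator a u) bound s∈generated
      where
      s∈generated : s ∈ proj₁ (generated (Image poset f))
      s∈generated = proj₂ (BL⊆DM (κ-join I≺κ (principal ∘ f) (λ i → generator (↓-isNormal _))
        {generated (Image poset f)} (generated-isJoin f))) λ upper → s-least (upper ∘ ⊆-generated)

-- Finite joins in a bounded distributive lattice.

module FiniteJoins (A : DLat ℓ) where

  open DLat A renaming (refl to ≤-refl; trans to ≤-trans; reflexive to ≤-reflexive; ⊥ to 0ᴬ; ⊤ to 1ᴬ)
  open Semilattice meetSemilattice
  open Ideals meetSemilattice using (IsDistributiveJoin)

  ⋁ : ∀ {n} → (Fin n → Carrier) → Carrier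
  ⋁ {ℕ.zero}  f = 0ᴬ
  ⋁ {ℕ.suc n} f = f Fin.zero ∨ ⋁ (f ∘ Fin.suc)

  ⋁-upper : ∀ {n} (f : Fin n → Carrier) k → f k ≤ ⋁ f
  ⋁-upper f Fin.zero    = x≤x∨y _ _
  ⋁-upper f (Fin.suc k) = ≤-trans (⋁-upper (f ∘ Fin.suc) k) (y≤x∨y _ _)

  ∧-0-least : ∀ a {u} → a ∧ 0ᴬ ≤ u
  ∧-0-least a = ≤-trans (x∧y≤y a 0ᴬ) (minimum _)

  ∧-⋁-least : ∀ {n} (f : Fin n → Carrier) a {u} → (∀ k → a ∧ f k ≤ u) → a ∧ ⋁ f ≤ u
  ∧-⋁-least {ℕ.zero}  f a bound = ∧-0-least a
  ∧-⋁-least {ℕ.suc n} f a bound = ≤-trans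
    (≤-reflexive (IsDistributiveLattice.∧-distribˡ-∨ isDistributiveLattice a _ _))
    (∨-least (bound Fin.zero) (∧-⋁-least (f ∘ Fin.suc) a (bound ∘ Fin.suc)))

  -- The join `s` lies below the finite join `⋁ f′`, over which meets distribute. Indices outside
  -- the range of `g` contribute only the bottom element.
  finite⇒joinDistributive : ExcludedMiddle ℓ → ∀ {I : Set ℓ} {n} → I ↣ Fin n → (f : I → Carrier) →
    ∀ {s} → IsJoin poset (Image poset f) s → IsDistributiveJoin (Image poset f) s
  finite⇒joinDistributive em {I} g f {s} (s-upper , s-least) = distributiveJoin s-upper λ a bound →
    ≤-trans (∧-monoʳ a s≤⋁) (∧-⋁-least f′ a (λ k → ∧-least (h k) bound))
    where
    h      = proj₁ (partialInverse em g)
    orZero = maybe′ f 0ᴬ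
    f′     = orZero ∘ h

    s≤⋁ : s ≤ ⋁ f′
    s≤⋁ = s-least λ (i , x≈fi) → ≤-trans (≤-reflexive x≈fi)
      (subst (λ m → orZero m ≤ ⋁ f′) (proj₂ (partialInverse em g) i) (⋁-upper f′ (to g i)))

    ∧-least : ∀ {a u} (m : Maybe I) → (∀ {x} → x ∈ Image poset f → a ∧ x ≤ u) → a ∧ orZero m ≤ u
    ∧-least (just i) bound = bound (i , Eq.refl)
    ∧-least nothing  bound = ∧-0-least _

  ω₀-joinDistributive : ExcludedMiddle ℓ → A ∈ ω₀ -JD
  ω₀-joinDistributive em I≺ω₀ = finite⇒joinDistributive em (proj₂ (≺ω₀⇒finite em I≺ω₀))

-- Rings of sets

not-∧ : ∀ a b → T (not (a ∧ᵇ b)) → T (not a ∨ᵇ not b)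
not-∧ true  _ ¬b = ¬b
not-∧ false _ _  = _

not-mono : ∀ {a b} → (T a → T b) → T (not b) → T (not a)
not-mono {false} _   _  = _
not-mono {true} {false} a⇒b _ = a⇒b _

-- Bool-valued, so that the subsets of a set in `Set ℓ` form a set in `Set ℓ`, as a carrier must,
-- and so that membership is proof-irrelevant and `∃ (_∈ˢ S)` has the cardinality of `S`.
Subset : Set ℓ → Set ℓ
Subset X = X → Bool

infix 4 _∈ˢ_

_∈ˢ_ : X → Subset X → Set
x ∈ˢ S = T (S x)

∈ˢ-≡ : ∀ {S : Subset X} {p q : ∃ (_∈ˢ S)} → proj₁ p ≡ proj₁ q → p ≡ q
∈ˢ-≡ {p = x , _} refl = cong (x ,_) (T-irrelevant _ _)

_∩ˢ_ : Subset X → Subset X → Subset X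
(S ∩ˢ S′) x = S x ∧ᵇ S′ x

fullˢ : Subset X
fullˢ _ = true

module Comprehension {ℓ} (em : ExcludedMiddle ℓ) where

  ｛_｝ˢ : {X : Set ℓ} → Pred X ℓ → Subset X
  ｛ P ｝ˢ x = ⌊ em {P x} ⌋

  ⋃ˢ : {I X : Set ℓ} → (I → Subset X) → Subset X
  ⋃ˢ f = ｛ (λ x → ∃ λ i → x ∈ˢ f i) ｝ˢ

-- Subsets of size below a regular cardinal.

module Smallness {ℓ} (em : ExcludedMiddle ℓ) (κ : RegularCardinal ℓ) where

  open Comprehension em
  open RegularCardinal κ using (isRegular)
  open IsRegular isRegular using (infinite; sums) public

  IsSmall : Subset ∣ κ ∣ → Set ℓ
  IsSmall S = ∃ (_∈ˢ S) ≺ ∣ κ ∣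

  small-⊆ : ∀ {S S′} → (_∈ˢ S) ⊆ (_∈ˢ S′) → IsSmall S′ → IsSmall S
  small-⊆ S⊆S′ = ≼-≺-trans (mk↣ {to = λ (x , x∈S) → x , S⊆S′ x∈S} λ eq → ∈ˢ-≡ (cong proj₁ eq))

  -- `toWitness` chooses for each point of the union a member containing it. This embeds the union
  -- in the sum, which is small by regularity.
  small-⋃ : ∀ {I} → I ≺ ∣ κ ∣ → (f : I → Subset ∣ κ ∣) → (∀ i → IsSmall (f i)) → IsSmall (⋃ˢ f)
  small-⋃ I≺κ f small = ≼-≺-trans
    (mk↣ {to = λ (x , x∈⋃) → let (i , x∈fi) = toWitness x∈⋃ in i , x , x∈fi}
      λ {p} {q} eq → ∈ˢ-≡ {S = ⋃ˢ f} {p} {q} (cong (proj₁ ∘ proj₂) eq))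
    (sums _ _ I≺κ small)

  small-subsingleton : ∀ {S} → (∀ {x y} → x ∈ˢ S → y ∈ˢ S → x ≡ y) → IsSmall S
  small-subsingleton unique = finite⇒≺ {n = 1} infinite (mk↣ {to = λ _ → Fin.zero}
    λ {p} {q} _ → ∈ˢ-≡ (unique (proj₂ p) (proj₂ q)))

  full-not-small : ∀ {S} → (∀ x → x ∈ˢ S) → ¬ IsSmall S
  full-not-small full (_ , κ⋠S) = κ⋠S (mk↣ {to = λ x → x , full x} (cong proj₁))

  element : ∣ κ ∣
  element = to infinite (lift 0)

Bool≺ : ω₀ ≼ κ → Lift ℓ Bool ≺ κ
Bool≺ ω₀≼κ = finite⇒≺ {n = 2} ω₀≼κ (mk↣ {to = λ (lift b) → if b then Fin.zero else Fin.suc Fin.zero}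
  λ { {lift true} {lift true} _ → refl ; {lift false} {lift false} _ → refl
    ; {lift true} {lift false} () ; {lift false} {lift true} () })

-- The lattice of a family of sets closed under finite intersections and `κ`-unions.

module SetLattice {ℓ} (em : ExcludedMiddle ℓ) {κ : Set ℓ} (ω₀≼κ : ω₀ ≼ κ) {X : Set ℓ}
  (IsOpen : Pred (Subset X) ℓ)
  (full-open : IsOpen fullˢ)
  (∩-open : ∀ S S′ → IsOpen S → IsOpen S′ → IsOpen (S ∩ˢ S′))
  (⋃-open : ∀ {I} → I ≺ κ → (f : I → Subset X) → (∀ i → IsOpen (f i)) → IsOpen (Comprehension.⋃ˢ em f))
  where

  open Comprehension em

  Open : Set ℓ
  Open = ∃ IsOpen

  infix 4 _∈ᵒ_ _⊑_

  _∈ᵒ_ : X → Open → Set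
  x ∈ᵒ S = x ∈ˢ proj₁ S

  record _⊑_ (S S′ : Open) : Set ℓ where
    constructor mk⊑
    field on : ∀ {x} → x ∈ᵒ S → x ∈ᵒ S′
  open _⊑_ public

  _∩ᵒ_ : Open → Open → Open
  (S , o) ∩ᵒ (S′ , o′) = S ∩ˢ S′ , ∩-open S S′ o o′

  ∈-∩⁺ : ∀ {x} S S′ → x ∈ᵒ S → x ∈ᵒ S′ → x ∈ᵒ S ∩ᵒ S′
  ∈-∩⁺ S S′ p q = Equivalence.from T-∧ (p , q)

  ∈-∩⁻ : ∀ {x} S S′ → x ∈ᵒ S ∩ᵒ S′ → x ∈ᵒ S × x ∈ᵒ S′
  ∈-∩⁻ S S′ = Equivalence.to T-∧

  ⋃ᵒ : ∀ {I} → I ≺ κ → (I → Open) → Open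
  ⋃ᵒ I≺κ f = ⋃ˢ (proj₁ ∘ f) , ⋃-open I≺κ (proj₁ ∘ f) (proj₂ ∘ f)

  ∅ᵒ : Open
  ∅ᵒ = ⋃ᵒ {Lift ℓ (Fin 0)} (finite⇒≺ ω₀≼κ (mk↣ (cong lift))) λ ()

  pair : Open → Open → Lift ℓ Bool → Open
  pair S S′ (lift b) = if b then S else S′

  _∪ᵒ_ : Open → Open → Open
  S ∪ᵒ S′ = ⋃ᵒ (Bool≺ ω₀≼κ) (pair S S′)

  ⋃-upper : ∀ {I} (I≺κ : I ≺ κ) (f : I → Open) i → f i ⊑ ⋃ᵒ I≺κ f
  ⋃-upper I≺κ f i = mk⊑ λ x∈fi → fromWitness (i , x∈fi)

  ∩-⋃-least : ∀ {I} (I≺κ : I ≺ κ) (f : I → Open) S {U} → (∀ i → S ∩ᵒ f i ⊑ U) → S ∩ᵒ ⋃ᵒ I≺κ f ⊑ U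
  ∩-⋃-least I≺κ f S bound = mk⊑ λ x∈ →
    let x∈S , x∈⋃ = ∈-∩⁻ S (⋃ᵒ I≺κ f) x∈
        i , x∈fi  = toWitness x∈⋃
    in bound i .on (∈-∩⁺ S (f i) x∈S x∈fi)

  ⊑-refl : ∀ {S} → S ⊑ S
  ⊑-refl = mk⊑ id

  ⊑-trans : ∀ {S S′ S″} → S ⊑ S′ → S′ ⊑ S″ → S ⊑ S″
  ⊑-trans p q = mk⊑ (q .on ∘ p .on)

  ∩-⊑ˡ : ∀ {S S′} → S ∩ᵒ S′ ⊑ S
  ∩-⊑ˡ {S} {S′} = mk⊑ (proj₁ ∘ ∈-∩⁻ S S′)

  ∩-⊑ʳ : ∀ {S S′} → S ∩ᵒ S′ ⊑ S′
  ∩-⊑ʳ {S} {S′} = mk⊑ (proj₂ ∘ ∈-∩⁻ S S′)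

  ∩-greatest : ∀ {S S′ U} → U ⊑ S → U ⊑ S′ → U ⊑ S ∩ᵒ S′
  ∩-greatest {S} {S′} p q = mk⊑ λ x∈U → ∈-∩⁺ S S′ (p .on x∈U) (q .on x∈U)

  ⋃-least : ∀ {I} (I≺κ : I ≺ κ) (f : I → Open) {U} → (∀ i → f i ⊑ U) → ⋃ᵒ I≺κ f ⊑ U
  ⋃-least I≺κ f bound = mk⊑ λ x∈ → let i , x∈fi = toWitness x∈ in bound i .on x∈fi

  dlat : DLat ℓ
  dlat = record
    { boundedLattice = record
      { Carrier = Open
      ; _≈_ = λ S S′ → S ⊑ S′ × S′ ⊑ S
      ; _≤_ = _⊑_
      ; _∨_ = _∪ᵒ_
      ; _∧_ = _∩ᵒ_
      ; ⊤ = fullˢ , full-open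
      ; ⊥ = ∅ᵒ
      ; isBoundedLattice = record
        { isLattice = isLattice
        ; maximum = λ _ → mk⊑ _
        ; minimum = λ _ → ⋃-least _ (λ ()) λ ()
        }
      }
    ; isDistributiveLattice = record
      { isLattice = isLattice
      ; ∧-distribˡ-∨ = λ S V W →
          ∩-⋃-least (Bool≺ ω₀≼κ) (pair V W) S
            (λ { (lift true)  → ∪-upper (S ∩ᵒ V) (S ∩ᵒ W) true
               ; (lift false) → ∪-upper (S ∩ᵒ V) (S ∩ᵒ W) false }) ,
          ⋃-least (Bool≺ ω₀≼κ) (pair (S ∩ᵒ V) (S ∩ᵒ W))
            (λ { (lift true)  → ∩-greatest ∩-⊑ˡ (⊑-trans ∩-⊑ʳ (∪-upper V W true))
               ; (lift false) → ∩-greatest ∩-⊑ˡ (⊑-trans ∩-⊑ʳ (∪-upper V W false)) })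
      }
    }
    where
    ∪-upper : ∀ S S′ b → pair S S′ (lift b) ⊑ S ∪ᵒ S′
    ∪-upper S S′ b = ⋃-upper (Bool≺ ω₀≼κ) (pair S S′) (lift b)

    isLattice : IsLattice (λ S S′ → S ⊑ S′ × S′ ⊑ S) _⊑_ _∪ᵒ_ _∩ᵒ_
    isLattice = record
      { isPartialOrder = record
        { isPreorder = record
          { isEquivalence = record
            { refl  = ⊑-refl , ⊑-refl
            ; sym   = swap
            ; trans = λ (p , q) (p′ , q′) → ⊑-trans p p′ , ⊑-trans q′ q
            }
          ; reflexive = proj₁
          ; trans = ⊑-trans
          }
        ; antisym = _,_
        }
      ; supremum = λ S S′ → ∪-upper S S′ true , ∪-upper S S′ false , λ U S⊑U S′⊑U →
          ⋃-least (Bool≺ ω₀≼κ) (pair S S′) λ { (lift true) → S⊑U ; (lift false) → S′⊑U }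
      ; infimum = λ S S′ → ∩-⊑ˡ , ∩-⊑ʳ , λ U → ∩-greatest
      }

  open Semilattice (DLat.meetSemilattice dlat) public
  open Ideals (DLat.meetSemilattice dlat) public

  -- A join that is a set-theoretic union is distributive, however many members it has, so D-ideals
  -- are closed under it.
  covered : ∀ {I : Set ℓ} (f : I → Open) {S} (E : DIdeal) →
            (∀ i → f i ⊑ S) → (∀ {x} → x ∈ᵒ S → ∃ λ i → x ∈ᵒ f i) →
            (∀ i → f i ∈ proj₁ E) → S ∈ proj₁ E
  covered f {S} (E , isDIdeal) below cover f∈E = IsDIdeal.join isDIdeal (Image (DLat.poset dlat) f)
    (λ { (i , V⊑fi , _) → IsDIdeal.down isDIdeal V⊑fi (f∈E i) })
    (distributiveJoin (λ { (i , V⊑fi , _) → ⊑-trans V⊑fi (below i) }) λ B bound → mk⊑ λ x∈ →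
      let x∈B , x∈S = ∈-∩⁻ B S x∈
          i , x∈fi  = cover x∈S
      in bound (i , ⊑-refl , ⊑-refl) .on (∈-∩⁺ B (f i) x∈B x∈fi))

  ∉∅ : ∀ {x} → ¬ x ∈ᵒ ∅ᵒ
  ∉∅ x∈∅ with () ← lower (proj₁ (toWitness x∈∅))

  disjoint⁺ : ∀ S U → (∀ {x} → x ∈ᵒ S → ¬ x ∈ᵒ U) → U ∈ ⟨ S , ∅ᵒ ⟩
  disjoint⁺ S U disjoint = mk⊑ λ x∈ → let x∈S , x∈U = ∈-∩⁻ S U x∈ in contradiction x∈U (disjoint x∈S)

  disjoint⁻ : ∀ S U → U ∈ ⟨ S , ∅ᵒ ⟩ → ∀ {x} → x ∈ᵒ S → ¬ x ∈ᵒ U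
  disjoint⁻ S U U∈ {x} x∈S x∈U = ∉∅ {x} (U∈ .on (∈-∩⁺ S U x∈S x∈U))

  -- The union of fewer than `κ` open sets is open, so a `κ`-join lies below it, and intersection
  -- distributes over unions.
  dlat∈κ-JD : dlat ∈ κ -JD
  dlat∈κ-JD I≺κ f (s-upper , s-least) = distributiveJoin s-upper λ S bound →
    ⊑-trans (∩-greatest ∩-⊑ˡ (⊑-trans ∩-⊑ʳ (s-least
      (λ { (i , x⊑fi , _) → ⊑-trans x⊑fi (⋃-upper I≺κ f i) }))))
      (∩-⋃-least I≺κ f S (λ i → bound (i , ⊑-refl , ⊑-refl)))

-- Small or full sets: a `μ`-proHeyting lattice that is not `κ`-proHeyting for larger `κ`.

module SmallOrFull {ℓ} (em : ExcludedMiddle ℓ) (μ : RegularCardinal ℓ) where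

  open Comprehension em
  open Smallness em μ

  Points : Set ℓ
  Points = ∣ μ ∣ ⊎ ⊤ {ℓ}

  IsSmallOrFull : Subset Points → Set ℓ
  IsSmallOrFull S = IsSmall (S ∘ inj₁) ⊎ (∀ x → x ∈ˢ S)

  ∩-smallOrFull : ∀ S S′ → IsSmallOrFull S → IsSmallOrFull S′ → IsSmallOrFull (S ∩ˢ S′)
  ∩-smallOrFull S S′ (inj₁ small) _            = inj₁ (small-⊆ (proj₁ ∘ Equivalence.to T-∧) small)
  ∩-smallOrFull S S′ (inj₂ full) (inj₁ small)  = inj₁ (small-⊆ (proj₂ ∘ Equivalence.to T-∧) small)
  ∩-smallOrFull S S′ (inj₂ full) (inj₂ full′)  = inj₂ (λ x → Equivalence.from T-∧ (full x , full′ x))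

  ⋃-smallOrFull : ∀ {I} → I ≺ ∣ μ ∣ → (f : I → Subset Points) →
    (∀ i → IsSmallOrFull (f i)) → IsSmallOrFull (⋃ˢ f)
  ⋃-smallOrFull I≺μ f o with em {∃ λ i → ∀ x → x ∈ˢ f i}
  ... | yes (i , full) = inj₂ (λ x → fromWitness (i , full x))
  ... | no none        = inj₁ (small-⋃ I≺μ (λ i → f i ∘ inj₁) small)
    where
    small : ∀ i → IsSmall (f i ∘ inj₁)
    small i with o i
    ... | inj₁ small = small
    ... | inj₂ full  = contradiction (i , full) none

  full-smallOrFull : IsSmallOrFull fullˢ
  full-smallOrFull = inj₂ λ _ → _

  open SetLattice em infinite IsSmallOrFull full-smallOrFull ∩-smallOrFull ⋃-smallOrFull

  A : DLat ℓ
  A = dlat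

  open DLat A using (poset) renaming (⊤ to 1ᴬ)

  union : Pred Open ℓ → Subset Points
  union S = ｛ (λ x → ∃ λ U → U ∈ S × x ∈ᵒ U) ｝ˢ

  -- If the union is not open, no upper bound is small on `μ`, since the union would then be small
  -- as well; so the whole space is the only upper bound.
  complete : ∀ S → ∃ (IsJoin poset S)
  complete S with em {IsSmallOrFull (union S)}
  ... | yes o = (_ , o) , (λ {U} U∈S → mk⊑ λ x∈U → fromWitness (U , U∈S , x∈U)) , λ {V} upper →
                mk⊑ λ x∈ → let U , U∈S , x∈U = toWitness x∈ in upper U∈S .on x∈U
  ... | no ¬o = 1ᴬ , (λ _ → mk⊑ _) , λ {V} upper → mk⊑ λ {x} _ → full V upper x
    where
    full : ∀ V → V ∈ UpperBounds poset S → ∀ x → x ∈ᵒ V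
    full (V , inj₁ small) upper = contradiction
      (inj₁ (small-⊆ {union S ∘ inj₁} (λ x∈ →
        let U , U∈S , x∈U = toWitness x∈ in upper U∈S .on x∈U) small)) ¬o
    full (V , inj₂ full) upper = full

  A∈μ-proH : A ∈ ∣ μ ∣ -proH
  A∈μ-proH = complete⇒κProHeyting dlat∈κ-JD complete

  singleton : Points → Open
  singleton x = ｛ x ≡_ ｝ˢ ,
    inj₁ (small-subsingleton (λ p q → inj₁-injective (trans (sym (toWitness p)) (toWitness q))))

  ∈-singleton⁺ : ∀ {x} → x ∈ᵒ singleton x
  ∈-singleton⁺ = fromWitness refl

  ∈-singleton⁻ : ∀ {x y} → y ∈ᵒ singleton x → x ≡ y
  ∈-singleton⁻ = toWitness

  ∞ : Points
  ∞ = inj₂ _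

  ∞-free : DIdeal
  ∞-free = annihilator (singleton ∞) ∅ᵒ

  ∞-free-join : IsJoin BL (Image BL (principal ∘ singleton ∘ inj₁)) ∞-free
  ∞-free-join =
    (λ { {F} (i , F≐ , _) {S} S∈F → disjoint⁺ (singleton ∞) S λ p q →
         contradiction (trans (∈-singleton⁻ (F≐ S∈F .on q)) (sym (∈-singleton⁻ p))) λ () }) ,
    λ {E} upper {S} S∈ → covered {I = ∃ λ i → inj₁ i ∈ᵒ S} (singleton ∘ inj₁ ∘ proj₁) E
      (λ (i , i∈S) → mk⊑ λ p → subst (_∈ˢ proj₁ S) (∈-singleton⁻ p) i∈S)
      (λ { {inj₁ i} i∈S → (i , i∈S) , ∈-singleton⁺
         ; {inj₂ _} ∞∈S → contradiction ∞∈S (disjoint⁻ (singleton ∞) S S∈ ∈-singleton⁺) })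
      (λ (i , _) → upper {principal (singleton (inj₁ i))} (i , id , id) ⊑-refl)

  -- An upper bound contains every point of `μ`, so it is not small and must be full. Hence the
  -- normal closure contains the top, to which `∞` belongs.
  ∞-free-not-normal : ∞-free ∉ DM
  ∞-free-not-normal (_ , closed) = disjoint⁻ (singleton ∞) 1ᴬ
    (closed {1ᴬ} λ {U} upper → mk⊑ λ {x} _ → full U upper x) ∈-singleton⁺ _
    where
    full : ∀ U → U ∈ UpperBounds poset (proj₁ ∞-free) → ∀ x → x ∈ᵒ U
    full (_ , inj₂ full)  _     = full
    full (_ , inj₁ small) upper = contradiction small (full-not-small λ i →
      upper {singleton (inj₁ i)} (disjoint⁺ (singleton ∞) (singleton (inj₁ i)) λ p q →
        contradiction (trans (∈-singleton⁻ p) (sym (∈-singleton⁻ q))) λ ())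
        .on ∈-singleton⁺)

  A∉κ-proH : ∀ {κ} → ∣ μ ∣ ≺ κ → A ∉ κ -proH
  A∉κ-proH μ≺κ (BL⊆DM , _) = ∞-free-not-normal (BL⊆DM
    (κ-join μ≺κ (principal ∘ singleton ∘ inj₁) (λ i → generator (↓-isNormal _)) {∞-free} ∞-free-join))

-- Two-sided sets: distributive `κ`-joins in a lattice that is not `κ`-proHeyting.

module TwoSided {ℓ} (em : ExcludedMiddle ℓ) (κ : RegularCardinal ℓ) where

  open Comprehension em
  open Smallness em κ

  data Points : Set ℓ where
    lo hi : Bool → ∣ κ ∣ → Points

  coˢ : {X : Set ℓ} → Subset X → Subset X
  coˢ S = not ∘ S

  -- `HighOpen` couples the two copies of `hi`: a set that meets one of them must be co-small on
  -- both. In particular `lo b ∪ hi b` is not open.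
  LowOpen HighOpen IsOpen : Subset Points → Set ℓ
  LowOpen S  = ∀ b → IsSmall (S ∘ lo b) ⊎ (∀ i → lo b i ∈ˢ S × hi b i ∈ˢ S)
  HighOpen S = (∀ b i → ¬ hi b i ∈ˢ S) ⊎ (∀ b → IsSmall (coˢ (S ∘ hi b)))
  IsOpen S   = LowOpen S × HighOpen S

  full-open : IsOpen fullˢ
  full-open = (λ b → inj₂ λ i → _) , inj₂ λ b → small-subsingleton λ ()

  small-∪ : ∀ {S S′} → IsSmall S → IsSmall S′ → IsSmall (λ x → S x ∨ᵇ S′ x)
  small-∪ {S} {S′} small small′ = small-⊆
    (λ x∈ → fromWitness ([ (λ p → lift true , p) , (λ p → lift false , p) ]′ (Equivalence.to T-∨ x∈)))
    (small-⋃ (Bool≺ infinite) (λ (lift b) → if b then S else S′)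
      λ { (lift true) → small ; (lift false) → small′ })

  ∩-open : ∀ S S′ → IsOpen S → IsOpen S′ → IsOpen (S ∩ˢ S′)
  ∩-open S S′ (low , high) (low′ , high′) = ∩-low , ∩-high high high′
    where
    ∩-low : LowOpen (S ∩ˢ S′)
    ∩-low b with low b | low′ b
    ... | inj₁ small | _           = inj₁ (small-⊆ (proj₁ ∘ Equivalence.to T-∧) small)
    ... | inj₂ _     | inj₁ small  = inj₁ (small-⊆ (proj₂ ∘ Equivalence.to T-∧) small)
    ... | inj₂ all   | inj₂ all′   = inj₂ λ i →
      Equivalence.from T-∧ (proj₁ (all i) , proj₁ (all′ i)) ,
      Equivalence.from T-∧ (proj₂ (all i) , proj₂ (all′ i))

    ∩-high : HighOpen S → HighOpen S′ → HighOpen (S ∩ˢ S′)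
    ∩-high (inj₁ none) _            = inj₁ λ b i → none b i ∘ proj₁ ∘ Equivalence.to T-∧
    ∩-high (inj₂ _)    (inj₁ none)  = inj₁ λ b i → none b i ∘ proj₂ ∘ Equivalence.to T-∧
    ∩-high (inj₂ cosmall) (inj₂ cosmall′) = inj₂ λ b → small-⊆
      (λ {i} → not-∧ (S (hi b i)) (S′ (hi b i)))
      (small-∪ {coˢ (S ∘ hi b)} {coˢ (S′ ∘ hi b)} (cosmall b) (cosmall′ b))

  ⋃-open : ∀ {I} → I ≺ ∣ κ ∣ → (f : I → Subset Points) → (∀ i → IsOpen (f i)) → IsOpen (⋃ˢ f)
  ⋃-open I≺κ f o = ⋃-low , ⋃-high
    where
    ⋃-low : LowOpen (⋃ˢ f)
    ⋃-low b with em {∃ λ i → ∀ j → lo b j ∈ˢ f i × hi b j ∈ˢ f i}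
    ... | yes (i , all) = inj₂ λ j → fromWitness (i , proj₁ (all j)) , fromWitness (i , proj₂ (all j))
    ... | no none       = inj₁ (small-⋃ I≺κ (λ i → f i ∘ lo b) small)
      where
      small : ∀ i → IsSmall (f i ∘ lo b)
      small i with proj₁ (o i) b
      ... | inj₁ small = small
      ... | inj₂ all   = contradiction (i , all) none

    ⋃-high : HighOpen (⋃ˢ f)
    ⋃-high with em {∃ λ i → ∀ b → IsSmall (coˢ (f i ∘ hi b))}
    ... | yes (i , cosmall) = inj₂ λ b →
      small-⊆ {S′ = coˢ (f i ∘ hi b)} (λ {j} → not-mono λ j∈ → fromWitness (i , j∈)) (cosmall b)
    ... | no none = inj₁ λ b j j∈ → let i , j∈fi = toWitness j∈ in empty i b j j∈fi
      where
      empty : ∀ i b j → ¬ hi b j ∈ˢ f i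
      empty i with proj₂ (o i)
      ... | inj₁ empty   = empty
      ... | inj₂ cosmall = contradiction (i , cosmall) none

  open SetLattice em infinite IsOpen full-open ∩-open ⋃-open

  A : DLat ℓ
  A = dlat

  open DLat A using (poset) renaming (⊤ to 1ᴬ)

  high : Open
  high = S , (λ b → inj₁ (small-subsingleton λ ())) , inj₂ λ b → small-subsingleton λ ()
    where
    S : Subset Points
    S (lo _ _) = false
    S (hi _ _) = true

  high-free : DIdeal
  high-free = annihilator high ∅ᵒ

  point : Bool → ∣ κ ∣ → Open
  point b i = ｛ lo b i ≡_ ｝ˢ ,
    (λ b′ → inj₁ (small-subsingleton λ p q → same (trans (sym (toWitness p)) (toWitness q)))) ,
    inj₁ λ _ _ p → contradiction (toWitness p) λ ()
    where
    same : ∀ {b b′ i j} → lo b i ≡ lo b′ j → i ≡ j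
    same refl = refl

  -- The upper bounds barrier b j of M b contain lo b and hi b, avoid lo (not b),
  -- and no non-empty co-small trace on hi lies below all of them.

  Barrier : Bool → ∣ κ ∣ → Pred Points ℓ
  Barrier b j x = (∀ b′ i → x ≡ lo b′ i → b′ ≡ b) × (∀ b′ → x ≡ hi b′ j → b′ ≡ b)

  barrier : Bool → ∣ κ ∣ → Open
  barrier b j = ｛ Barrier b j ｝ˢ , low , inj₂ λ b′ → small-subsingleton λ p q → trans (≡j p) (sym (≡j q))
    where
    low : LowOpen ｛ Barrier b j ｝ˢ
    low b′ with b′ ≟ b
    ... | yes refl = inj₂ λ i →
      fromWitness ((λ { _ _ refl → refl }) , λ _ ()) , fromWitness ((λ _ _ ()) , λ { _ refl → refl })
    ... | no b′≢b  = inj₁ (small-subsingleton λ p → contradiction (proj₁ (toWitness p) _ _ refl) b′≢b)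

    ≡j : ∀ {b′ i} → hi b′ i ∈ˢ coˢ ｛ Barrier b j ｝ˢ → i ≡ j
    ≡j p = decidable-stable em λ i≢j → toWitnessFalse p ((λ _ _ ()) , λ { _ refl → contradiction refl i≢j })

  M : Bool → Pred Open ℓ
  M b S = ∀ {x} → x ∈ᵒ S → ∃ λ i → x ≡ lo b i

  barrier-upper : ∀ b j → barrier b j ∈ UpperBounds poset (M b)
  barrier-upper b j S∈M = mk⊑ λ x∈S → fromWitness (on-lo (proj₂ (S∈M x∈S)))
    where
    on-lo : ∀ {x i} → x ≡ lo b i → x ∈ Barrier b j
    on-lo refl = (λ { _ _ refl → refl }) , λ _ ()

  -- A set below all barriers meets `lo` only in `lo b` and misses `hi (not b)` altogether. It is
  -- therefore not co-small there, which forces it to be empty on all of `hi`.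
  M-isNormal : ∀ b → IsNormal (M b)
  M-isNormal b = (λ S∈M u → u S∈M) , λ {S} below → λ
    { {lo b′ i} x∈S → i , cong (λ c → lo c i)
        (proj₁ (toWitness (below (barrier-upper b i) .on x∈S)) _ _ refl)
    ; {hi b′ i} x∈S → contradiction x∈S (high-empty S below b′ i) }
    where
    avoids : ∀ S → S ∈ LowerBounds poset (UpperBounds poset (M b)) → ∀ i → ¬ hi (not b) i ∈ᵒ S
    avoids S below i x∈S =
      not-¬ {b} refl (sym (proj₂ (toWitness (below (barrier-upper b i) .on x∈S)) _ refl))

    high-empty : ∀ S → S ∈ LowerBounds poset (UpperBounds poset (M b)) → ∀ b′ i → ¬ hi b′ i ∈ᵒ S
    high-empty (_ , _ , inj₁ empty) _ = empty
    high-empty S@(_ , _ , inj₂ cosmall) below = contradiction (cosmall (not b))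
      (full-not-small λ i → not-mono {b = false} (avoids S below i) _)

  side : Bool → DIdeal
  side b = M b , normal⇒DIdeal (M-isNormal b)

  sides : Lift ℓ Bool → DIdeal
  sides (lift b) = side b

  low-small : ∀ S → S ∈ proj₁ high-free → ∀ b → IsSmall (proj₁ S ∘ lo b)
  low-small S@(_ , low , _) S∈ b with low b
  ... | inj₁ small = small
  ... | inj₂ all   = contradiction (proj₂ (all element)) (disjoint⁻ high S S∈ _)

  part : ∀ S → S ∈ proj₁ high-free → Bool → Open
  part S S∈ b = P ,
    (λ b′ → inj₁ (small-⊆ (proj₂ ∘ Equivalence.to T-∧) (low-small S S∈ b′))) , inj₁ λ _ _ ()
    where
    P : Subset Points
    P (lo b′ i) = ⌊ b ≟ b′ ⌋ ∧ᵇ proj₁ S (lo b′ i)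
    P (hi _ _)  = false

  -- An open set disjoint from `hi` is small on both copies of `lo`, so its traces on them are open;
  -- they lie in the two sides and cover it.
  high-free-join : IsJoin BL (Image BL (sides)) high-free
  high-free-join =
    (λ { (lift b , F≐ , _) {S} S∈F → disjoint⁺ high S
         λ { {hi _ _} _ x∈S → contradiction (proj₂ (F≐ S∈F x∈S)) λ () } }) ,
    λ {E} upper {S} S∈ → covered (part S S∈ ∘ lower) E
      (λ (lift b) → mk⊑ λ { {lo _ _} x∈ → proj₂ (Equivalence.to T-∧ x∈) })
      (λ { {lo b i} x∈S → lift b , Equivalence.from T-∧ (fromWitness refl , x∈S)
         ; {hi _ _} x∈S → contradiction x∈S (disjoint⁻ high S S∈ _) })
      (λ (lift b) → upper {side b} (lift b , id , id) {part S S∈ b}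
        λ { {lo b′ i} x∈ → i , cong (λ c → lo c i)
              (sym (toWitness (proj₁ (Equivalence.to (T-∧ {⌊ b ≟ b′ ⌋}) x∈)))) })

  -- An upper bound contains every `point b i`, so it is small on neither copy of `lo` and must
  -- contain `lo b` and `hi b` for both `b`.
  high-free-not-normal : high-free ∉ DM
  high-free-not-normal (_ , closed) = disjoint⁻ high 1ᴬ
    (closed {1ᴬ} λ {U} upper → mk⊑ λ {x} _ → full U upper x) {hi true element} _ _
    where
    full : ∀ U → U ∈ UpperBounds poset (proj₁ high-free) → ∀ x → x ∈ᵒ U
    full U upper = λ { (lo b i) → proj₁ (all b i) ; (hi b i) → proj₂ (all b i) }
      where
      all : ∀ b i → lo b i ∈ᵒ U × hi b i ∈ᵒ U
      all b with proj₁ (proj₂ U) b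
      ... | inj₂ all   = all
      ... | inj₁ small = contradiction small (full-not-small λ i →
        upper {point b i} (disjoint⁺ high (point b i)
          λ { {hi _ _} _ p → contradiction (toWitness p) λ () })
          .on (fromWitness refl))

  A∈κ-JD : A ∈ ∣ κ ∣ -JD
  A∈κ-JD = dlat∈κ-JD

  A∉κ-proH : A ∉ ∣ κ ∣ -proH
  A∉κ-proH (BL⊆DM , _) = high-free-not-normal (BL⊆DM
    -- Having only two members, this is a `κ`-join for every infinite `κ`, `ω₀` included.
    (κ-join (Bool≺ infinite) sides (λ (lift b) → generator (M-isNormal b))
      {high-free} high-free-join))

theorem4p8 : ∀ {ℓ : Level} →
    ExcludedMiddle (suc ℓ) → Extensionality (suc ℓ) (suc ℓ) →
    ((μ κ : RegularCardinal ℓ) → ∣ μ ∣ ≼ ∣ κ ∣ →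
    (∣ κ ∣ -proH ⊆ ∣ μ ∣ -proH) × (∣ μ ∣ ≺ ∣ κ ∣ → ∣ κ ∣ -proH ⊂ ∣ μ ∣ -proH)) ×
    (proH {ℓ} ≐ ⋂ (RegularCardinal ℓ) (λ κ → ∣ κ ∣ -proH)) ×
    ((κ : RegularCardinal ℓ) → ∣ κ ∣ -proH ⊂ ∣ κ ∣ -JD) ×
    ((ω₀ {ℓ} -proH ⊂ ω₀ {ℓ} -JD) × (ω₀ {ℓ} -JD ≐ U))
theorem4p8 {ℓ} em ext =
  (λ μ κ μ≼κ → (λ {A} → antitone μ≼κ {A}) , λ μ≺κ → (λ {A} → antitone μ≼κ {A}) ,
    λ μ⊆κ → SmallOrFull.A∉κ-proH em₀ μ μ≺κ
      (μ⊆κ {SmallOrFull.A em₀ μ} (SmallOrFull.A∈μ-proH em₀ μ))) ,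
  ( (λ {A} proHeyting κ → normal-joins⇒κProHeyting A
      (λ _ _ _ {E} _ → ProHeyting⇒normal A proHeyting E))
  , λ {A} → κProHeyting⇒ProHeyting A λ X → successor X , X≺successor X) ,
  κ-proH⊂κ-JD ,
  κ-proH⊂κ-JD (record { ∣_∣ = ω₀ ; isRegular = ω₀-isRegular em₀ }) ,
  _ , λ {A} _ → FiniteJoins.ω₀-joinDistributive A em₀
  where
  -- The constructions at level `ℓ` use this restriction; the higher level serves the generated
  -- D-ideals, whose definition quantifies over all D-ideals.
  em₀ : ExcludedMiddle ℓ
  em₀ {P} = map′ lower lift (em {Lift (suc ℓ) P})

  open Successor em₀ (lower-extensionality (suc ℓ) (suc ℓ) ext) using (successor; X≺successor)
  open module S (A : DLat ℓ) = Semilattice (DLat.meetSemilattice A)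

  antitone : ∀ {μ κ : Set ℓ} → μ ≼ κ → κ -proH ⊆ μ -proH
  antitone μ≼κ {A} = κProHeyting-antitone A μ≼κ

  κ-proH⊂κ-JD : (κ : RegularCardinal ℓ) → ∣ κ ∣ -proH ⊂ ∣ κ ∣ -JD
  κ-proH⊂κ-JD κ = (λ {A} → κProHeyting⇒κJoinDistributive A em) , λ JD⊆proH →
    TwoSided.A∉κ-proH em₀ κ (JD⊆proH {TwoSided.A em₀ κ} (TwoSided.A∈κ-JD em₀ κ))
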